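{- Let $\widehat{G}_1$ be the signed graph constructed below. Then $\chi_{fb}(\widehat{G}_1)=2+\frac{2}{85}=\frac{172}{85}$.
   Context: A signed graph $(G,\sigma)$ is a graph with a signature $\sigma:E(G)\to\{+,-\}$; a cycle is negative if it has an odd number of negative edges; a vertex set is balanced if it induces no negative cycle. A balanced $(p,q)$-coloring assigns to each vertex $q$ colors from $\{1,\dots,p\}$ so that each color class is balanced; $\chi_{fb}$ is the minimum of $p/q$ over such colorings. $(K_4,-)$ denotes $K_4$ with all edges negative. The signed graph $\widehat{W}$: vertices $u,v,w,z,t,x_1,\dots,x_5$; edges $wx_i$ ($1\le i\le5$), $x_1x_2,x_2x_3,x_3x_4,x_4x_5,x_5x_1$, $zx_2,zx_3,zu,zv$, $tx_4,tx_5,tu,tv$, $ux_1,ux_2,ux_5,uv$, $vx_3,vx_4$; the edges $ux_2$ and $vx_4$ are positive and all other edges are negative. The signed graph $\widehat{W}'$ is obtained from $\widehat{W}$ by adding vertices $a_1,a_2,a_3,b_1,b_2,b_3$ with negative edges $a_1a_2,a_2a_3,a_1a_3,a_1x_1,a_1x_2,a_2u$, positive edges $a_2x_2,a_3u,a_3x_1$, negative edges $b_1b_2,b_2b_3,b_1b_3,b_1x_3,b_1x_4,b_2v$ and positive edges $b_2x_4,b_3v,b_3x_3$. In $\widehat{W}'$ the seven specified negative triangles are $wx_1x_2$, $wx_1x_5$, $wx_3x_4$, $zx_2x_3$, $tx_4x_5$, $a_1a_2a_3$, $b_1b_2b_3$. Let $\widehat{U}$ be obtained from $(K_4,-)$ by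 identifying each of its six edges with the edge $uv$ of a distinct copy of $\widehat{W}'$; $\widehat{U}$ thus has $42$ specified negative triangles. $\widehat{G}_1$ is obtained from $\widehat{U}$ by adding, for each of the $42$ specified triangles, a new vertex adjacent to its three vertices, with signs on the three new edges chosen so that the resulting $K_4$ is switching equivalent to $(K_4,-)$ (i.e., all four of its triangles are negative). -}

module Defs where

open import Data.Nat using (ℕ; zero; suc; _≤_)
open import Data.Fin using (Fin; zero; suc)
import Data.Fin.Properties as FinP
open import Data.Fin.Subset using (Subset; _∈_; ∣_∣)
open import Data.Bool using (Bool; true; false; _∧_; _∨_)
open import Data.Maybe using (Maybe; just; nothing)
open import Data.Product using (Σ; _×_; _,_)
open import Data.Sum using (_⊎_; inj₁; inj₂)
import Data.Sum.Properties as SumP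
import Data.Product.Properties as ProdP
open import Data.List using (List; []; _∷_; _++_; length; map; concatMap)
open import Data.List.Relation.Unary.All using (All)
open import Data.List.Relation.Unary.Unique.Propositional using (Unique)
open import Relation.Nullary using (¬_; does)
open import Relation.Binary.PropositionalEquality using (_≡_)
open import Relation.Binary.Definitions using (DecidableEquality)

-- Signed graphs (simple graphs, signature given by a symmetric partial
-- function: sgn x y = nothing means x,y non-adjacent).

data Sign : Set where
  pos neg : Sign

_·_ : Sign → Sign → Sign
pos · s = s
neg · pos = neg
neg · neg = pos

record SignedGraph : Set₁ where
  field
    V   : Set
    sgn : V → V → Maybe Sign

module _ (G : SignedGraph) where
  open SignedGraph G

  walkSign : List V → Maybe Sign
  walkSign [] = just pos
  walkSign (a ∷ []) = just pos
  walkSign (a ∷ b ∷ rest) with sgn a b | walkSign (b ∷ rest)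
  ... | just s | just r = just (s · r)
  ... | _      | _      = nothing

  cycleSign : List V → Maybe Sign
  cycleSign [] = nothing
  cycleSign (v ∷ vs) = walkSign (v ∷ vs ++ v ∷ [])

  IsNegCycle : List V → Set
  IsNegCycle vs = (3 ≤ length vs) × Unique vs × (cycleSign vs ≡ just neg)

  Balanced : (V → Set) → Set
  Balanced S = (vs : List V) → All S vs → ¬ IsNegCycle vs

  BalancedColoring : ℕ → ℕ → Set
  BalancedColoring p q =
    Σ (V → Subset p) λ c →
      ((v : V) → ∣ c v ∣ ≡ q) × ((i : Fin p) → Balanced (λ v → i ∈ c v))

Loc : Set
Loc = Fin 16

u v w z t x₁ x₂ x₃ x₄ x₅ a₁ a₂ a₃ b₁ b₂ b₃ : Loc
u = # 0
  where open import Data.Fin using (#_)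
v = # 1
  where open import Data.Fin using (#_)
w = # 2
  where open import Data.Fin using (#_)
z = # 3
  where open import Data.Fin using (#_)
t = # 4
  where open import Data.Fin using (#_)
x₁ = # 5
  where open import Data.Fin using (#_)
x₂ = # 6
  where open import Data.Fin using (#_)
x₃ = # 7
  where open import Data.Fin using (#_)
x₄ = # 8
  where open import Data.Fin using (#_)
x₅ = # 9
  where open import Data.Fin using (#_)
a₁ = # 10
  where open import Data.Fin using (#_)
a₂ = # 11
  where open import Data.Fin using (#_)
a₃ = # 12
  where open import Data.Fin using (#_)
b₁ = # 13
  where open import Data.Fin using (#_)
b₂ = # 14
  where open import Data.Fin using (#_)
b₃ = # 15
  where open import Data.Fin using (#_)

edgesW : List (Loc × Loc × Sign)
edgesW =
  (w , x₁ , neg) ∷ (w , x₂ , neg) ∷ (w , x₃ , neg) ∷ (w , x₄ , neg) ∷ (w , x₅ , neg) ∷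
  (x₁ , x₂ , neg) ∷ (x₂ , x₃ , neg) ∷ (x₃ , x₄ , neg) ∷ (x₄ , x₅ , neg) ∷ (x₅ , x₁ , neg) ∷
  (z , x₂ , neg) ∷ (z , x₃ , neg) ∷ (z , u , neg) ∷ (z , v , neg) ∷
  (t , x₄ , neg) ∷ (t , x₅ , neg) ∷ (t , u , neg) ∷ (t , v , neg) ∷
  (u , x₁ , neg) ∷ (u , x₂ , pos) ∷ (u , x₅ , neg) ∷ (u , v , neg) ∷
  (v , x₃ , neg) ∷ (v , x₄ , pos) ∷ []

edgesW' : List (Loc × Loc × Sign)
edgesW' = edgesW ++
  (a₁ , a₂ , neg) ∷ (a₂ , a₃ , neg) ∷ (a₁ , a₃ , neg) ∷ (a₁ , x₁ , neg) ∷ (a₁ , x₂ , neg) ∷ (a₂ , u , neg) ∷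
  (a₂ , x₂ , pos) ∷ (a₃ , u , pos) ∷ (a₃ , x₁ , pos) ∷
  (b₁ , b₂ , neg) ∷ (b₂ , b₃ , neg) ∷ (b₁ , b₃ , neg) ∷ (b₁ , x₃ , neg) ∷ (b₁ , x₄ , neg) ∷ (b₂ , v , neg) ∷
  (b₂ , x₄ , pos) ∷ (b₃ , v , pos) ∷ (b₃ , x₃ , pos) ∷ []

triangle : Fin 7 → Loc × Loc × Loc
triangle zero = (w , x₁ , x₂)
triangle (suc zero) = (w , x₁ , x₅)
triangle (suc (suc zero)) = (w , x₃ , x₄)
triangle (suc (suc (suc zero))) = (z , x₂ , x₃)
triangle (suc (suc (suc (suc zero)))) = (t , x₄ , x₅)
triangle (suc (suc (suc (suc (suc zero))))) = (a₁ , a₂ , a₃)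
triangle (suc (suc (suc (suc (suc (suc zero)))))) = (b₁ , b₂ , b₃)

-- vertices: the 4 vertices of K4, the 14 private vertices (all but u,v)
-- of each of the 6 copies of W-hat', and one new vertex per specified
-- triangle (6 copies × 7 triangles)
VG₁ : Set
VG₁ = Fin 4 ⊎ ((Fin 6 × Fin 14) ⊎ (Fin 6 × Fin 7))

_≟V_ : DecidableEquality VG₁
_≟V_ = SumP.≡-dec FinP._≟_
         (SumP.≡-dec (ProdP.≡-dec FinP._≟_ FinP._≟_)
                     (ProdP.≡-dec FinP._≟_ FinP._≟_))

k4edge : Fin 6 → Fin 4 × Fin 4
k4edge zero = (# 0 , # 1)
  where open import Data.Fin using (#_)
k4edge (suc zero) = (# 0 , # 2)
  where open import Data.Fin using (#_)
k4edge (suc (suc zero)) = (# 0 , # 3)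
  where open import Data.Fin using (#_)
k4edge (suc (suc (suc zero))) = (# 1 , # 2)
  where open import Data.Fin using (#_)
k4edge (suc (suc (suc (suc zero)))) = (# 1 , # 3)
  where open import Data.Fin using (#_)
k4edge (suc (suc (suc (suc (suc zero))))) = (# 2 , # 3)
  where open import Data.Fin using (#_)

emb : Fin 6 → Loc → VG₁
emb e zero with k4edge e
... | (i , _) = inj₁ i
emb e (suc zero) with k4edge e
... | (_ , j) = inj₁ j
emb e (suc (suc l)) = inj₂ (inj₁ (e , l))

edgesCopy : Fin 6 → List (VG₁ × VG₁ × Sign)
edgesCopy e = map (λ { (a , b , s) → (emb e a , emb e b , s) }) edgesW'

-- the new vertex on triangle j of copy e, joined to its three vertices;
-- all specified triangles have three negative edges, so taking the three
-- new edges negative makes every triangle of the new K4 negative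
edgesTri : Fin 6 → Fin 7 → List (VG₁ × VG₁ × Sign)
edgesTri e j with triangle j
... | (p , q , r) =
  (y , emb e p , neg) ∷ (y , emb e q , neg) ∷ (y , emb e r , neg) ∷ []
  where y = inj₂ (inj₂ (e , j))

edgesG₁ : List (VG₁ × VG₁ × Sign)
edgesG₁ = concatMap (λ e → edgesCopy e ++ concatMap (edgesTri e) (allFin 7)) (allFin 6)
  where open import Data.List using (allFin)

lookupSign : List (VG₁ × VG₁ × Sign) → VG₁ → VG₁ → Maybe Sign
lookupSign [] x y = nothing
lookupSign ((a , b , s) ∷ es) x y with (does (a ≟V x) ∧ does (b ≟V y)) ∨ (does (a ≟V y) ∧ does (b ≟V x))
... | true = just s
... | false = lookupSign es x y

G₁ : SignedGraph
G₁ = record { V = VG₁ ; sgn = lookupSign edgesG₁ }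

{-# OPTIONS --safe #-}

-- Lower bound. Let K run over K₄ with weight one and over the 42 negative K₄'s
-- formed by a specified triangle and its apex; this puts total weight
-- 4 + 42 · 4 = 172 on the vertices. A balanced set S has at most two vertices
-- in a negative K₄. If S contains both ends of an edge of K₄, then in the copy
-- of W-hat' on that edge S must miss a specified triangle, and there it has at
-- most one vertex of K. So the weight of S is at most 2 + 42 · 2 - 1 = 85
-- (if S has at most one vertex in K₄ this is immediate), and averaging over
-- the colours gives 172 q ≤ 85 p.
--
-- Upper bound. If p / q = 172 / 85, every colour class attains equality above.
-- For p = 172 this forces each pair in K₄ to occur in 28 classes and suggests
-- letting each single vertex occur in one. The balanced extensions of the four
-- traces on {u, v} to W-hat' come from linear programming, and the copies can
-- be filled independently as they meet only in K₄.
module Submission where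

open import Defs
open import Data.Bool using (Bool; true; false)
import Data.Bool.Properties as Bool
open import Data.Empty using (⊥)
open import Data.Fin using (Fin; zero; suc; #_)
import Data.Fin.Properties as Fin
open import Data.Fin.Subset using (Subset; ∣_∣)
open import Data.List using (List; []; _∷_; _++_; length; map; foldr; concatMap; replicate; allFin)
open import Data.List.Membership.Propositional using (_∈_; lose)
import Data.List.Membership.DecPropositional as DecMembership
open import Data.List.Membership.Propositional.Properties using (∈-allFin)
open import Data.List.Relation.Unary.All as All using (All; []; _∷_)
open import Data.List.Relation.Unary.All.Properties using (¬All⇒Any¬; map⁺)
open import Data.List.Relation.Unary.Any as Any using (Any; here; there)
import Data.List.Relation.Unary.Unique.DecPropositional as DecUnique
open import Data.Maybe using (Maybe; just; nothing; is-just; maybe; _<∣>_)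
import Data.Maybe as Maybe
import Data.Maybe.Properties as Maybe
open import Data.Nat using (ℕ; zero; suc; _+_; _*_; _≤_; _<_; z≤n; s≤s; s≤s⁻¹; _≤?_)
open import Data.Nat.ListAction using (sum)
open import Data.Nat.Properties using (≤-trans; ≤-reflexive; +-mono-≤; +-assoc; +-suc; *-comm; module ≤-Reasoning)
import Data.Nat.Properties as ℕ
open import Data.Nat.Solver using (module +-*-Solver)
open import Data.Product using (Σ; ∃; _×_; _,_; proj₁; proj₂)
open import Data.Sum using (_⊎_; inj₁; inj₂)
open import Data.Unit using (⊤; tt)
import Data.Vec.Relation.Unary.All as VecAll
open import Data.Vec.Relation.Unary.All.Properties using (lookup⁺)
open import Data.Vec as Vec using (Vec; []; _∷_; lookup)
open import Data.Vec.Properties using (lookup⇒[]=; []=⇒lookup; lookup-map)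
open import Function using (_∘_)
open import Relation.Binary.Definitions using (DecidableEquality)
open import Relation.Binary.PropositionalEquality using (_≡_; refl; sym; trans; cong; cong₂; subst)
open import Relation.Nullary using (¬_; Dec; yes; no; contradiction)
open import Relation.Nullary.Decidable using (from-yes; _×-dec_; _⊎-dec_)

-- Deciding negative cycles

infix 4 _≟S_

_≟S_ : DecidableEquality Sign
pos ≟S pos = yes refl
pos ≟S neg = no λ ()
neg ≟S pos = no λ ()
neg ≟S neg = yes refl

isNegCycle? : (vs : List VG₁) → Dec (IsNegCycle G₁ vs)
isNegCycle? vs =
  (3 ≤? length vs) ×-dec (DecUnique.unique? _≟V_ vs ×-dec Maybe.≡-dec _≟S_ (cycleSign G₁ vs) (just neg))

-- Sums and double counting

bit : Bool → ℕ
bit true  = 1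
bit false = 0

∣∣-head-tail : ∀ {n} (s : Subset (suc n)) → ∣ s ∣ ≡ bit (Vec.head s) + ∣ Vec.tail s ∣
∣∣-head-tail (true  ∷ s) = refl
∣∣-head-tail (false ∷ s) = refl

weight : {A : Set} → (A → Bool) → List A → ℕ
weight S vs = sum (map (bit ∘ S) vs)

module _ {A : Set} where

  weight-++ : (S : A → Bool) (xs ys : List A) → weight S (xs ++ ys) ≡ weight S xs + weight S ys
  weight-++ S []       ys = refl
  weight-++ S (x ∷ xs) ys = trans (cong (bit (S x) +_) (weight-++ S xs ys)) (sym (+-assoc (bit (S x)) _ _))

  weight-concatMap : {B : Set} (S : A → Bool) (f : B → List A) (xs : List B) →
                     weight S (concatMap f xs) ≡ sum (map (weight S ∘ f) xs)
  weight-concatMap S f []       = refl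
  weight-concatMap S f (x ∷ xs) =
    trans (weight-++ S (f x) (concatMap f xs)) (cong (weight S (f x) +_) (weight-concatMap S f xs))

  weight-none : (S : A → Bool) (xs : List A) → ¬ Any (λ x → S x ≡ true) xs → weight S xs ≡ 0
  weight-none S []       _    = refl
  weight-none S (x ∷ xs) none with S x in x∈
  ... | true  = contradiction (here x∈) none
  ... | false = weight-none S xs (none ∘ there)

  sum-≤ : (f : A → ℕ) (b : ℕ) → (∀ x → f x ≤ b) → (xs : List A) → sum (map f xs) ≤ length xs * b
  sum-≤ f b f≤b []       = z≤n
  sum-≤ f b f≤b (x ∷ xs) = +-mono-≤ (f≤b x) (sum-≤ f b f≤b xs)

  sum-< : (f : A → ℕ) (b : ℕ) → (∀ x → f x ≤ b) → {xs : List A} → Any (λ x → f x < b) xs →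
          sum (map f xs) < length xs * b
  sum-< f b f≤b {x ∷ xs} (here fx<b) = +-mono-≤ fx<b (sum-≤ f b f≤b xs)
  sum-< f b f≤b {x ∷ xs} (there any) =
    ≤-trans (≤-reflexive (sym (+-suc (f x) _))) (+-mono-≤ (f≤b x) (sum-< f b f≤b any))

  sum-const : (f : A → ℕ) (q : ℕ) → (∀ x → f x ≡ q) → (xs : List A) → sum (map f xs) ≡ length xs * q
  sum-const f q f≡q []       = refl
  sum-const f q f≡q (x ∷ xs) = cong₂ _+_ (f≡q x) (sum-const f q f≡q xs)

  sum-+ : (f g : A → ℕ) (xs : List A) → sum (map (λ x → f x + g x) xs) ≡ sum (map f xs) + sum (map g xs)
  sum-+ f g []       = refl
  sum-+ f g (x ∷ xs) = trans (cong (f x + g x +_) (sum-+ f g xs)) (interchange (f x) (g x) _ _)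
    where
    open +-*-Solver
    interchange : ∀ a b c d → (a + b) + (c + d) ≡ (a + c) + (b + d)
    interchange = solve 4 (λ a b c d → (a :+ b) :+ (c :+ d) := (a :+ c) :+ (b :+ d)) refl

  sum-cong : {f g : A → ℕ} → (∀ x → f x ≡ g x) → (xs : List A) → sum (map f xs) ≡ sum (map g xs)
  sum-cong f≡g []       = refl
  sum-cong f≡g (x ∷ xs) = cong₂ _+_ (f≡g x) (sum-cong f≡g xs)

  -- Double counting by induction on the number of colours: the heads of the subsets form the class
  -- of the first colour, which contributes at most `b`.
  sum-∣∣-≤ : ∀ {p b} (vs : List A) (c : A → Subset p) →
             (∀ i → weight (λ v → lookup (c v) i) vs ≤ b) → sum (map (∣_∣ ∘ c) vs) ≤ p * b
  sum-∣∣-≤ {zero}      vs c class≤b =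
    ≤-trans (sum-≤ (∣_∣ ∘ c) 0 (λ v → ≤-reflexive (empty (c v))) vs) (≤-reflexive (ℕ.*-zeroʳ (length vs)))
    where
    empty : (s : Subset 0) → ∣ s ∣ ≡ 0
    empty [] = refl
  sum-∣∣-≤ {suc p} {b} vs c class≤b = begin
    sum (map (∣_∣ ∘ c) vs)                                            ≡⟨ sum-cong (∣∣-head-tail ∘ c) vs ⟩
    sum (map (λ v → bit (Vec.head (c v)) + ∣ Vec.tail (c v) ∣) vs)    ≡⟨ sum-+ _ _ vs ⟩
    weight (Vec.head ∘ c) vs + sum (map (∣_∣ ∘ Vec.tail ∘ c) vs)      ≤⟨ +-mono-≤ head≤b (sum-∣∣-≤ vs (Vec.tail ∘ c) tail≤b) ⟩
    b + p * b                                                         ∎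
    where
    open ≤-Reasoning
    lookup-head : ∀ {n} (s : Subset (suc n)) → Vec.head s ≡ lookup s zero
    lookup-head (x ∷ s) = refl
    lookup-tail : ∀ {n} (s : Subset (suc n)) i → lookup (Vec.tail s) i ≡ lookup s (suc i)
    lookup-tail (x ∷ s) i = refl
    head≤b : weight (Vec.head ∘ c) vs ≤ b
    head≤b = ≤-trans (≤-reflexive (sum-cong (cong bit ∘ lookup-head ∘ c) vs)) (class≤b zero)
    tail≤b : ∀ i → weight (λ v → lookup (Vec.tail (c v)) i) vs ≤ b
    tail≤b i = ≤-trans (≤-reflexive (sum-cong (λ v → cong bit (lookup-tail (c v) i)) vs)) (class≤b (suc i))

-- Negative K₄'s

module _ (G : SignedGraph) where
  open SignedGraph G using (V)

  IsNegK₄ : List V → Set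
  IsNegK₄ (x ∷ y ∷ z ∷ t ∷ []) =
    IsNegCycle G (x ∷ y ∷ z ∷ []) × IsNegCycle G (x ∷ y ∷ t ∷ []) ×
    IsNegCycle G (x ∷ z ∷ t ∷ []) × IsNegCycle G (y ∷ z ∷ t ∷ [])
  IsNegK₄ _ = ⊥

  -- Any three of the four vertices span a negative triangle.
  weight-negK₄ : (S : V → Bool) → Balanced G (λ v → S v ≡ true) → ∀ vs → IsNegK₄ vs → weight S vs ≤ 2
  weight-negK₄ S balanced (x ∷ y ∷ z ∷ t ∷ []) (xyz , xyt , xzt , yzt)
    with S x in x∈ | S y in y∈ | S z in z∈ | S t in t∈
  ... | true  | true  | true  | _     = contradiction xyz (balanced _ (x∈ ∷ y∈ ∷ z∈ ∷ []))
  ... | true  | true  | false | true  = contradiction xyt (balanced _ (x∈ ∷ y∈ ∷ t∈ ∷ []))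
  ... | true  | false | true  | true  = contradiction xzt (balanced _ (x∈ ∷ z∈ ∷ t∈ ∷ []))
  ... | false | true  | true  | true  = contradiction yzt (balanced _ (y∈ ∷ z∈ ∷ t∈ ∷ []))
  ... | true  | true  | false | false = s≤s (s≤s z≤n)
  ... | true  | false | true  | false = s≤s (s≤s z≤n)
  ... | true  | false | false | true  = s≤s (s≤s z≤n)
  ... | true  | false | false | false = s≤s z≤n
  ... | false | true  | true  | false = s≤s (s≤s z≤n)
  ... | false | true  | false | true  = s≤s (s≤s z≤n)
  ... | false | true  | false | false = s≤s z≤n
  ... | false | false | true  | true  = s≤s (s≤s z≤n)
  ... | false | false | true  | false = s≤s z≤n
  ... | false | false | false | true  = s≤s z≤n
  ... | false | false | false | false = z≤n

isNegK₄? : (vs : List VG₁) → Dec (IsNegK₄ G₁ vs)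
isNegK₄? (x ∷ y ∷ z ∷ t ∷ []) =
  isNegCycle? _ ×-dec isNegCycle? _ ×-dec isNegCycle? _ ×-dec isNegCycle? _
isNegK₄? []                      = no λ ()
isNegK₄? (_ ∷ [])                = no λ ()
isNegK₄? (_ ∷ _ ∷ [])            = no λ ()
isNegK₄? (_ ∷ _ ∷ _ ∷ [])        = no λ ()
isNegK₄? (_ ∷ _ ∷ _ ∷ _ ∷ _ ∷ _) = no λ ()

-- The lower bound

k₄ : List VG₁
k₄ = map inj₁ (allFin 4)

triangleVertices : Fin 7 → List Loc
triangleVertices j = let (x , y , z) = triangle j in x ∷ y ∷ z ∷ []

triangleK₄ : Fin 6 → Fin 7 → List VG₁
triangleK₄ e j = inj₂ (inj₂ (e , j)) ∷ map (emb e) (triangleVertices j)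

copyVertices : Fin 6 → List VG₁
copyVertices e = concatMap (triangleK₄ e) (allFin 7)

-- Weights are encoded by repetition: a vertex is listed once for each K₄ through it, so `w`, for
-- instance, counts three times in its copy.
weightedVertices : List VG₁
weightedVertices = k₄ ++ concatMap copyVertices (allFin 6)

isNegK₄-k₄ : IsNegK₄ G₁ k₄
isNegK₄-k₄ = from-yes (isNegK₄? k₄)

isNegK₄-triangleK₄ : ∀ e j → IsNegK₄ G₁ (triangleK₄ e j)
isNegK₄-triangleK₄ = from-yes (Fin.all? λ e → Fin.all? λ j → isNegK₄? (triangleK₄ e j))

-- The last six triangles come from the gadgets. If a balanced set contains `u`, `x₁` and `x₂`, they
-- exclude `a₃`, `a₂` and `a₁`, so a specified triangle is missed; likewise for `v`, `x₃`, `x₄` and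
-- the `b` gadget. The first eight cycles lie in W-hat.
negCycles : List (List Loc)
negCycles =
  (u ∷ v ∷ t ∷ []) ∷ (u ∷ v ∷ z ∷ []) ∷ (u ∷ x₁ ∷ x₅ ∷ []) ∷
  (u ∷ v ∷ x₃ ∷ x₂ ∷ []) ∷ (u ∷ v ∷ x₄ ∷ x₅ ∷ []) ∷ (u ∷ x₂ ∷ w ∷ x₅ ∷ []) ∷
  (u ∷ v ∷ x₄ ∷ w ∷ x₂ ∷ []) ∷ (u ∷ v ∷ x₃ ∷ w ∷ x₅ ∷ []) ∷
  (u ∷ x₁ ∷ a₃ ∷ []) ∷ (u ∷ x₂ ∷ a₂ ∷ []) ∷ (x₁ ∷ x₂ ∷ a₁ ∷ []) ∷
  (v ∷ x₃ ∷ b₃ ∷ []) ∷ (v ∷ x₄ ∷ b₂ ∷ []) ∷ (x₃ ∷ x₄ ∷ b₁ ∷ []) ∷ []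

isNegCycle-negCycles : ∀ e → All (IsNegCycle G₁ ∘ map (emb e)) negCycles
isNegCycle-negCycles = from-yes (Fin.all? λ e → All.all? (isNegCycle? ∘ map (emb e)) negCycles)

open DecMembership (Fin._≟_ {16}) using (_∈?_)

-- Every set that contains xs and meets each triangle in the list contains one
-- of negCycles, as witnessed by choosing vertices in the triangles one by one.
Refuted : List Loc → List (Fin 7) → Set
Refuted xs js = Any (All (_∈ xs)) negCycles ⊎ Branch js
  where
  Branch : List (Fin 7) → Set
  Branch []       = ⊥
  Branch (j ∷ js) = All (λ x → Refuted (x ∷ xs) js) (triangleVertices j)

refuted? : ∀ xs js → Dec (Refuted xs js)
refuted? xs []       = Any.any? (All.all? (_∈? xs)) negCycles ⊎-dec no λ ()
refuted? xs (j ∷ js) =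
  Any.any? (All.all? (_∈? xs)) negCycles ⊎-dec All.all? (λ x → refuted? (x ∷ xs) js) (triangleVertices j)

-- By hand: the triangles on `uv` exclude `z` and `t`, so exactly one of `x₂`, `x₃` and exactly one
-- of `x₄`, `x₅` is present. If `w` is present, the cycles through `w` leave only `x₃` with `x₄`,
-- which the `b` gadget forbids. If not, exactly one of any two consecutive vertices of the 5-cycle
-- `x₁` to `x₅` is present, which parity rules out.
refuted-uv : Refuted (u ∷ v ∷ []) (allFin 7)
refuted-uv = from-yes (refuted? (u ∷ v ∷ []) (allFin 7))

k₄-cases : (f : Fin 4 → Bool) → weight f (allFin 4) ≤ 1 ⊎
           ∃ λ e → f (proj₁ (k4edge e)) ≡ true × f (proj₂ (k4edge e)) ≡ true
k₄-cases f with f (# 0) in ∈₀ | f (# 1) in ∈₁ | f (# 2) in ∈₂ | f (# 3) in ∈₃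
... | true  | true  | _     | _     = inj₂ (# 0 , ∈₀ , ∈₁)
... | true  | false | true  | _     = inj₂ (# 1 , ∈₀ , ∈₂)
... | true  | false | false | true  = inj₂ (# 2 , ∈₀ , ∈₃)
... | false | true  | true  | _     = inj₂ (# 3 , ∈₁ , ∈₂)
... | false | true  | false | true  = inj₂ (# 4 , ∈₁ , ∈₃)
... | false | false | true  | true  = inj₂ (# 5 , ∈₂ , ∈₃)
... | true  | false | false | false = inj₁ (s≤s z≤n)
... | false | true  | false | false = inj₁ (s≤s z≤n)
... | false | false | true  | false = inj₁ (s≤s z≤n)
... | false | false | false | true  = inj₁ (s≤s z≤n)
... | false | false | false | false = inj₁ z≤n

module _ (S : VG₁ → Bool) (balanced : Balanced G₁ (λ v → S v ≡ true)) where

  In : VG₁ → Set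
  In x = S x ≡ true

  Meets : Fin 6 → Fin 7 → Set
  Meets e j = Any (In ∘ emb e) (triangleVertices j)

  meets? : ∀ e j → Dec (Meets e j)
  meets? e j = Any.any? (λ l → S (emb e l) Bool.≟ true) (triangleVertices j)

  refuted⇒missed : ∀ e xs js → Refuted xs js → All (In ∘ emb e) xs → ¬ All (Meets e) js
  refuted⇒missed e xs js (inj₁ any) xs∈ _ =
    let (isNeg , vs⊆xs) = All.lookupAny (isNegCycle-negCycles e) any
    in balanced _ (map⁺ (All.map (All.lookup xs∈) vs⊆xs)) isNeg
  refuted⇒missed e xs (j ∷ js) (inj₂ all) xs∈ (meet ∷ meets) =
    -- Follow the branch of a vertex of `S` in triangle `j`.
    let (refuted , l∈) = All.lookupAny all meet
    in refuted⇒missed e _ js refuted (l∈ ∷ xs∈) meets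

  weight-triangle : ∀ e j → weight S (triangleK₄ e j) ≤ 2
  weight-triangle e j = weight-negK₄ G₁ S balanced (triangleK₄ e j) (isNegK₄-triangleK₄ e j)

  -- Only the apex is left to count.
  weight-missed : ∀ e j → ¬ Meets e j → weight S (triangleK₄ e j) < 2
  weight-missed e j missed =
    s≤s (+-mono-≤ (bit≤1 (S _)) (≤-reflexive (weight-none (S ∘ emb e) (triangleVertices j) missed)))
    where
    bit≤1 : ∀ b → bit b ≤ 1
    bit≤1 true  = s≤s z≤n
    bit≤1 false = z≤n

  weight-copy : ∀ e → weight S (copyVertices e) ≤ 14
  weight-copy e = begin
    weight S (copyVertices e)                        ≡⟨ weight-concatMap S (triangleK₄ e) (allFin 7) ⟩
    sum (map (weight S ∘ triangleK₄ e) (allFin 7))   ≤⟨ sum-≤ (weight S ∘ triangleK₄ e) 2 (weight-triangle e) (allFin 7) ⟩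
    14                                               ∎
    where open ≤-Reasoning

  weight-copy-uv : ∀ e → In (emb e u) → In (emb e v) → weight S (copyVertices e) < 14
  weight-copy-uv e u∈ v∈ = begin-strict
    weight S (copyVertices e)                        ≡⟨ weight-concatMap S (triangleK₄ e) (allFin 7) ⟩
    sum (map (weight S ∘ triangleK₄ e) (allFin 7))   <⟨ sum-< (weight S ∘ triangleK₄ e) 2 (weight-triangle e) missed ⟩
    14                                               ∎
    where
    open ≤-Reasoning
    missed : Any (λ j → weight S (triangleK₄ e j) < 2) (allFin 7)
    missed = Any.map (weight-missed e _)
      (¬All⇒Any¬ (meets? e) (allFin 7) (refuted⇒missed e _ _ refuted-uv (u∈ ∷ v∈ ∷ [])))

  weight-weightedVertices : weight S weightedVertices ≤ 85
  weight-weightedVertices = begin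
    weight S weightedVertices                                            ≡⟨ weight-++ S k₄ (concatMap copyVertices (allFin 6)) ⟩
    weight S k₄ + weight S (concatMap copyVertices (allFin 6))           ≡⟨ cong (weight S k₄ +_) (weight-concatMap S copyVertices (allFin 6)) ⟩
    weight S k₄ + sum (map (weight S ∘ copyVertices) (allFin 6))         ≤⟨ bound (k₄-cases (S ∘ inj₁)) ⟩
    85                                                                   ∎
    where
    open ≤-Reasoning
    bound : (weight S k₄ ≤ 1 ⊎ ∃ λ e → In (emb e u) × In (emb e v)) →
            weight S k₄ + sum (map (weight S ∘ copyVertices) (allFin 6)) ≤ 85
    -- `1 + 6 * 14 = 85`.
    bound (inj₁ k₄≤1)          = +-mono-≤ k₄≤1 (sum-≤ (weight S ∘ copyVertices) 14 weight-copy (allFin 6))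
    -- The loss in copy `e` pays for the second vertex in K₄: `2 + 83 = 85`.
    bound (inj₂ (e , u∈ , v∈)) = +-mono-≤ (weight-negK₄ G₁ S balanced k₄ isNegK₄-k₄)
      (s≤s⁻¹ (sum-< (weight S ∘ copyVertices) 14 weight-copy (lose (∈-allFin e) (weight-copy-uv e u∈ v∈))))

lower-bound : ∀ p q → BalancedColoring G₁ p q → 172 * q ≤ 85 * p
lower-bound p q (c , ∣c∣≡q , balanced) = begin
  172 * q                              ≡⟨ sum-const (∣_∣ ∘ c) q ∣c∣≡q weightedVertices ⟨
  sum (map (∣_∣ ∘ c) weightedVertices) ≤⟨ sum-∣∣-≤ weightedVertices c class≤85 ⟩
  p * 85                               ≡⟨ *-comm p 85 ⟩
  85 * p                               ∎
  where
  open ≤-Reasoning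
  class≤85 : ∀ i → weight (λ v → lookup (c v) i) weightedVertices ≤ 85
  class≤85 i = weight-weightedVertices (λ v → lookup (c v) i)
    (λ vs vs∈ → balanced i vs (All.map (lookup⇒[]= i _) vs∈))

-- The optimal colouring

·-comm : ∀ a b → a · b ≡ b · a
·-comm pos pos = refl
·-comm pos neg = refl
·-comm neg pos = refl
·-comm neg neg = refl

·-telescope : ∀ a b c → (a · b) · (b · c) ≡ a · c
·-telescope pos pos c   = refl
·-telescope pos neg pos = refl
·-telescope pos neg neg = refl
·-telescope neg pos c   = refl
·-telescope neg neg pos = refl
·-telescope neg neg neg = refl

-- Switching the ends by `a` and `b` turns the sign `s` into `a · s · b`, which is `pos` exactly
-- when `s ≡ a · b`. An end marked `nothing` lies outside the set, and the edge is then
-- unconstrained.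
Compatible : Maybe Sign → Maybe Sign → Sign → Set
Compatible (just a) (just b) s = s ≡ a · b
Compatible (just _) nothing  _ = ⊤
Compatible nothing  _        _ = ⊤

compatible? : ∀ m n s → Dec (Compatible m n s)
compatible? (just a) (just b) s = s ≟S a · b
compatible? (just _) nothing  _ = yes tt
compatible? nothing  _        _ = yes tt

Compatible-sym : ∀ m n {s} → Compatible m n s → Compatible n m s
Compatible-sym (just a) (just b) s≡ab = trans s≡ab (·-comm a b)
Compatible-sym (just _) nothing  _    = tt
Compatible-sym nothing  (just _) _    = tt
Compatible-sym nothing  nothing  _    = tt

module _ (G : SignedGraph) where
  open SignedGraph G

  -- A partial switching is recorded by the signs on its support, so that
  -- switching makes all edges inside the support positive.
  module _ (σ : V → Maybe Sign) (compatible : ∀ x y {s} → sgn x y ≡ just s → Compatible (σ x) (σ y) s) where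

    edge-sign : ∀ {x y a b s} → σ x ≡ just a → σ y ≡ just b → sgn x y ≡ just s → s ≡ a · b
    edge-sign {x} {y} σx σy e with σ x | σ y | compatible x y e
    edge-sign refl refl e | _ | _ | s≡ab = s≡ab

    -- The switching sign of each inner vertex enters twice and cancels, leaving those of the two
    -- ends.
    walk-sign : ∀ {x y a b s} vs → σ x ≡ just a → All (λ v → ∃ λ c → σ v ≡ just c) vs → σ y ≡ just b →
                walkSign G (x ∷ vs ++ y ∷ []) ≡ just s → s ≡ a · b
    walk-sign {x} {y} [] σx [] σy walk with sgn x y in xy
    -- A one-edge walk has sign `s · pos`, where `pos` is the sign of the one-vertex tail.
    walk-sign {b = b} [] σx [] σy refl | just s = trans (·-comm s pos) (edge-sign σx σy xy)
    walk-sign {x} {y} (z ∷ vs) σx ((c , σz) ∷ σvs) σy walk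
      with sgn x z in xz | walkSign G (z ∷ vs ++ y ∷ []) in zy
    walk-sign {a = a} {b} (z ∷ vs) σx ((c , σz) ∷ σvs) σy refl | just s | just r =
      trans (cong₂ _·_ (edge-sign σx σz xz) (walk-sign vs σz σvs σy zy)) (·-telescope a c b)

    -- The easy half of Harary's criterion: a closed walk in the support has sign `a · a`.
    support-balanced : Balanced G (λ v → ∃ λ a → σ v ≡ just a)
    support-balanced (v ∷ vs) ((a , σv) ∷ σvs) (_ , _ , isNeg) = neg≢square a (walk-sign vs σv σvs σv isNeg)
      where
      neg≢square : ∀ a → ¬ neg ≡ a · a
      neg≢square pos ()
      neg≢square neg ()

-- Each edge is listed in one direction but looked up in both, hence the symmetry required of `P`.
lookupSign-all : {P : VG₁ × VG₁ × Sign → Set} → (∀ {x y s} → P (x , y , s) → P (y , x , s)) →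
                 ∀ {es} → All P es → ∀ x y {s} → lookupSign es x y ≡ just s → P (x , y , s)
lookupSign-all P-sym {(a , b , _) ∷ _} (p ∷ ps) x y eq
  with a ≟V x | b ≟V y | a ≟V y | b ≟V x
lookupSign-all P-sym (p ∷ ps) x y refl | yes refl | yes refl | _        | _        = p
lookupSign-all P-sym (p ∷ ps) x y refl | yes _    | no _     | yes refl | yes refl = P-sym p
lookupSign-all P-sym (p ∷ ps) x y refl | no _     | _        | yes refl | yes refl = P-sym p
lookupSign-all P-sym (p ∷ ps) x y eq   | yes _    | no _     | yes _    | no _     = lookupSign-all P-sym ps x y eq
lookupSign-all P-sym (p ∷ ps) x y eq   | yes _    | no _     | no _     | _        = lookupSign-all P-sym ps x y eq
lookupSign-all P-sym (p ∷ ps) x y eq   | no _     | _        | yes _    | no _     = lookupSign-all P-sym ps x y eq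
lookupSign-all P-sym (p ∷ ps) x y eq   | no _     | _        | no _     | _        = lookupSign-all P-sym ps x y eq

-- Balance quantifies over all cycles; a switching certifies it by one decidable condition per
-- listed edge.
IsSwitching : (VG₁ → Maybe Sign) → Set
IsSwitching σ = All (λ (x , y , s) → Compatible (σ x) (σ y) s) edgesG₁

supports : ∀ {p} → Vec (VG₁ → Maybe Sign) p → VG₁ → Subset p
supports σs v = Vec.map (λ σ → is-just (σ v)) σs

switchings⇒colouring : ∀ {p q} (σs : Vec (VG₁ → Maybe Sign) p) → (∀ i → IsSwitching (lookup σs i)) →
                       (∀ v → ∣ supports σs v ∣ ≡ q) → BalancedColoring G₁ p q
switchings⇒colouring σs switching ∣supports∣≡q = supports σs , ∣supports∣≡q , λ i vs vs∈ →
  support-balanced G₁ (lookup σs i)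
    (λ x y → lookupSign-all (λ {x} {y} → Compatible-sym (lookup σs i x) (lookup σs i y)) (switching i) x y)
    vs (All.map (λ {v} i∈ → ∈-support (trans (sym (lookup-map i (λ σ → is-just (σ v)) σs)) ([]=⇒lookup i∈))) vs∈)
  where
  ∈-support : {m : Maybe Sign} → is-just m ≡ true → ∃ λ a → m ≡ just a
  ∈-support {just a} _ = a , refl

-- The explicit colour classes

pattern ⊕ = just pos
pattern ⊖ = just neg
pattern ○ = nothing

-- Signs of w, z, t, … in the order of Loc, with u and v left out. In the pools
-- the first of u, v that is present is taken to be ⊕.
Extension : Set
Extension = Vec (Maybe Sign) 14

-- Each of the seven patterns misses exactly one specified triangle, a different one each time. With
-- multiplicity 4 they fill the 28 classes containing both `u` and `v`.
poolUV : List Extension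
poolUV =
  replicate  4 (⊕ ∷ ○ ∷ ○ ∷ ○ ∷ ○ ∷ ○ ∷ ⊖ ∷ ○ ∷ ○ ∷ ⊖ ∷ ○ ∷ ○ ∷ ○ ∷ ⊖ ∷ []) ++
  replicate  4 (⊖ ∷ ○ ∷ ○ ∷ ○ ∷ ○ ∷ ⊕ ∷ ○ ∷ ○ ∷ ○ ∷ ⊖ ∷ ○ ∷ ⊖ ∷ ○ ∷ ○ ∷ []) ++
  replicate  4 (○ ∷ ○ ∷ ○ ∷ ⊖ ∷ ⊕ ∷ ○ ∷ ⊖ ∷ ○ ∷ ○ ∷ ○ ∷ ○ ∷ ○ ∷ ○ ∷ ⊖ ∷ []) ++
  replicate  4 (○ ∷ ○ ∷ ○ ∷ ○ ∷ ○ ∷ ⊕ ∷ ○ ∷ ⊖ ∷ ○ ∷ ○ ∷ ⊕ ∷ ⊖ ∷ ⊕ ∷ ○ ∷ []) ++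
  replicate  4 (○ ∷ ○ ∷ ○ ∷ ○ ∷ ⊕ ∷ ○ ∷ ⊖ ∷ ○ ∷ ○ ∷ ○ ∷ ⊕ ∷ ⊕ ∷ ○ ∷ ○ ∷ []) ++
  replicate  4 (○ ∷ ○ ∷ ○ ∷ ○ ∷ ⊕ ∷ ○ ∷ ○ ∷ ⊖ ∷ ○ ∷ ○ ∷ ⊕ ∷ ⊕ ∷ ○ ∷ ○ ∷ []) ++
  replicate  4 (○ ∷ ○ ∷ ○ ∷ ⊖ ∷ ○ ∷ ⊕ ∷ ⊖ ∷ ○ ∷ ⊕ ∷ ⊖ ∷ ○ ∷ ○ ∷ ○ ∷ ○ ∷ [])

-- There are `85 - 28 = 57` patterns here and as many in `poolV`. Tightness makes every pattern
-- outside `poolUV` meet all seven specified triangles.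
poolU : List Extension
poolU =
  replicate 18 (⊖ ∷ ⊖ ∷ ⊖ ∷ ○ ∷ ⊕ ∷ ○ ∷ ⊕ ∷ ○ ∷ ⊖ ∷ ○ ∷ ⊕ ∷ ○ ∷ ⊕ ∷ ⊖ ∷ []) ++
  replicate 17 (○ ∷ ⊖ ∷ ⊖ ∷ ⊖ ∷ ○ ∷ ⊕ ∷ ○ ∷ ○ ∷ ⊕ ∷ ⊖ ∷ ○ ∷ ⊖ ∷ ⊕ ∷ ○ ∷ []) ++
  replicate  5 (⊕ ∷ ○ ∷ ○ ∷ ○ ∷ ○ ∷ ⊖ ∷ ○ ∷ ⊖ ∷ ○ ∷ ⊖ ∷ ⊕ ∷ ⊕ ∷ ⊖ ∷ ○ ∷ []) ++
  replicate  5 (⊕ ∷ ⊖ ∷ ○ ∷ ⊖ ∷ ○ ∷ ○ ∷ ⊖ ∷ ○ ∷ ○ ∷ ⊖ ∷ ○ ∷ ○ ∷ ○ ∷ ⊕ ∷ []) ++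
  replicate  4 (○ ∷ ⊖ ∷ ○ ∷ ○ ∷ ⊕ ∷ ○ ∷ ⊕ ∷ ⊖ ∷ ⊖ ∷ ○ ∷ ⊕ ∷ ⊖ ∷ ○ ∷ ○ ∷ []) ++
  replicate  1 (○ ∷ ○ ∷ ○ ∷ ○ ∷ ⊕ ∷ ⊖ ∷ ⊕ ∷ ⊖ ∷ ○ ∷ ○ ∷ ⊕ ∷ ○ ∷ ○ ∷ ⊖ ∷ []) ++
  replicate  1 (⊕ ∷ ⊖ ∷ ○ ∷ ○ ∷ ○ ∷ ○ ∷ ○ ∷ ⊖ ∷ ⊕ ∷ ⊖ ∷ ○ ∷ ⊕ ∷ ⊖ ∷ ○ ∷ []) ++
  replicate  1 (⊖ ∷ ○ ∷ ⊖ ∷ ○ ∷ ⊕ ∷ ○ ∷ ⊕ ∷ ○ ∷ ⊖ ∷ ○ ∷ ⊕ ∷ ○ ∷ ⊕ ∷ ⊖ ∷ []) ++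
  replicate  1 (○ ∷ ⊖ ∷ ○ ∷ ○ ∷ ⊕ ∷ ○ ∷ ⊕ ∷ ⊖ ∷ ⊖ ∷ ○ ∷ ○ ∷ ○ ∷ ⊕ ∷ ⊖ ∷ []) ++
  replicate  1 (○ ∷ ⊖ ∷ ○ ∷ ⊖ ∷ ○ ∷ ⊕ ∷ ⊖ ∷ ○ ∷ ⊕ ∷ ○ ∷ ○ ∷ ○ ∷ ⊖ ∷ ⊕ ∷ []) ++
  replicate  1 (○ ∷ ○ ∷ ○ ∷ ⊖ ∷ ○ ∷ ⊕ ∷ ⊖ ∷ ○ ∷ ⊕ ∷ ⊖ ∷ ○ ∷ ○ ∷ ⊖ ∷ ○ ∷ []) ++
  replicate  1 (⊖ ∷ ⊖ ∷ ⊖ ∷ ○ ∷ ○ ∷ ⊕ ∷ ○ ∷ ○ ∷ ○ ∷ ⊖ ∷ ⊕ ∷ ○ ∷ ○ ∷ ⊕ ∷ []) ++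
  replicate  1 (⊕ ∷ ○ ∷ ⊖ ∷ ○ ∷ ○ ∷ ⊖ ∷ ○ ∷ ○ ∷ ○ ∷ ○ ∷ ⊕ ∷ ⊕ ∷ ○ ∷ ○ ∷ [])

poolV : List Extension
poolV =
  replicate 17 (⊖ ∷ ⊖ ∷ ⊖ ∷ ○ ∷ ⊕ ∷ ○ ∷ ○ ∷ ⊕ ∷ ○ ∷ ○ ∷ ⊕ ∷ ⊕ ∷ ⊖ ∷ ○ ∷ []) ++
  replicate 11 (⊖ ∷ ⊖ ∷ ⊖ ∷ ○ ∷ ⊕ ∷ ○ ∷ ○ ∷ ⊕ ∷ ⊖ ∷ ⊕ ∷ ○ ∷ ⊖ ∷ ○ ∷ ⊕ ∷ []) ++
  replicate  9 (⊕ ∷ ○ ∷ ⊖ ∷ ⊖ ∷ ○ ∷ ⊖ ∷ ○ ∷ ○ ∷ ○ ∷ ⊕ ∷ ⊖ ∷ ○ ∷ ⊖ ∷ ○ ∷ []) ++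
  replicate  5 (○ ∷ ○ ∷ ○ ∷ ⊖ ∷ ⊕ ∷ ⊖ ∷ ○ ∷ ⊕ ∷ ○ ∷ ⊕ ∷ ○ ∷ ○ ∷ ⊖ ∷ ○ ∷ []) ++
  replicate  5 (○ ∷ ○ ∷ ○ ∷ ⊕ ∷ ⊖ ∷ ○ ∷ ⊕ ∷ ○ ∷ ○ ∷ ⊖ ∷ ⊕ ∷ ⊖ ∷ ○ ∷ ⊕ ∷ []) ++
  replicate  2 (○ ∷ ○ ∷ ⊖ ∷ ⊖ ∷ ⊕ ∷ ⊖ ∷ ○ ∷ ⊕ ∷ ○ ∷ ⊕ ∷ ⊖ ∷ ○ ∷ ⊖ ∷ ○ ∷ []) ++
  replicate  1 (⊖ ∷ ⊖ ∷ ⊖ ∷ ○ ∷ ○ ∷ ○ ∷ ⊕ ∷ ○ ∷ ○ ∷ ⊕ ∷ ○ ∷ ○ ∷ ○ ∷ ⊕ ∷ []) ++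
  replicate  1 (⊖ ∷ ⊖ ∷ ⊖ ∷ ○ ∷ ⊕ ∷ ○ ∷ ⊕ ∷ ○ ∷ ○ ∷ ⊕ ∷ ⊖ ∷ ⊖ ∷ ○ ∷ ○ ∷ []) ++
  replicate  1 (⊖ ∷ ⊖ ∷ ○ ∷ ⊕ ∷ ○ ∷ ○ ∷ ⊕ ∷ ○ ∷ ⊖ ∷ ⊕ ∷ ○ ∷ ⊖ ∷ ○ ∷ ⊕ ∷ []) ++
  replicate  1 (⊖ ∷ ⊖ ∷ ○ ∷ ⊕ ∷ ○ ∷ ○ ∷ ⊕ ∷ ○ ∷ ○ ∷ ⊕ ∷ ○ ∷ ⊖ ∷ ○ ∷ ○ ∷ []) ++
  replicate  1 (○ ∷ ○ ∷ ⊖ ∷ ⊖ ∷ ⊕ ∷ ⊖ ∷ ○ ∷ ⊕ ∷ ○ ∷ ⊕ ∷ ⊖ ∷ ⊕ ∷ ⊖ ∷ ○ ∷ []) ++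
  replicate  1 (⊕ ∷ ○ ∷ ⊖ ∷ ⊖ ∷ ○ ∷ ⊖ ∷ ○ ∷ ○ ∷ ⊕ ∷ ○ ∷ ○ ∷ ⊕ ∷ ○ ∷ ○ ∷ []) ++
  replicate  1 (○ ∷ ○ ∷ ○ ∷ ⊖ ∷ ⊕ ∷ ⊖ ∷ ○ ∷ ⊕ ∷ ○ ∷ ⊕ ∷ ○ ∷ ⊕ ∷ ○ ∷ ○ ∷ []) ++
  replicate  1 (⊖ ∷ ⊖ ∷ ⊖ ∷ ○ ∷ ⊕ ∷ ○ ∷ ⊕ ∷ ○ ∷ ○ ∷ ⊕ ∷ ⊖ ∷ ⊖ ∷ ○ ∷ ⊕ ∷ [])

-- The remaining `172 - 28 - 2 * 57 = 30` classes.
pool∅ : List Extension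
pool∅ =
  replicate 24 (○ ∷ ○ ∷ ○ ∷ ⊕ ∷ ○ ∷ ⊖ ∷ ⊕ ∷ ⊖ ∷ ⊖ ∷ ○ ∷ ○ ∷ ○ ∷ ○ ∷ ⊖ ∷ []) ++
  replicate  1 (⊕ ∷ ⊕ ∷ ⊕ ∷ ○ ∷ ○ ∷ ⊖ ∷ ○ ∷ ○ ∷ ○ ∷ ○ ∷ ⊕ ∷ ○ ∷ ○ ∷ ⊖ ∷ []) ++
  replicate  1 (○ ∷ ○ ∷ ⊕ ∷ ⊕ ∷ ⊖ ∷ ⊕ ∷ ○ ∷ ⊖ ∷ ○ ∷ ⊖ ∷ ⊕ ∷ ○ ∷ ⊖ ∷ ⊕ ∷ []) ++
  replicate  1 (○ ∷ ○ ∷ ○ ∷ ○ ∷ ⊕ ∷ ○ ∷ ⊕ ∷ ⊖ ∷ ○ ∷ ⊕ ∷ ⊖ ∷ ⊖ ∷ ○ ∷ ⊕ ∷ []) ++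
  replicate  1 (○ ∷ ⊕ ∷ ○ ∷ ○ ∷ ⊖ ∷ ○ ∷ ⊕ ∷ ⊖ ∷ ○ ∷ ○ ∷ ⊕ ∷ ○ ∷ ○ ∷ ⊕ ∷ []) ++
  replicate  1 (⊕ ∷ ⊕ ∷ ⊕ ∷ ⊖ ∷ ○ ∷ ⊖ ∷ ○ ∷ ○ ∷ ○ ∷ ⊕ ∷ ⊖ ∷ ○ ∷ ⊕ ∷ ⊖ ∷ []) ++
  replicate  1 (○ ∷ ⊕ ∷ ○ ∷ ⊕ ∷ ⊖ ∷ ○ ∷ ⊕ ∷ ⊖ ∷ ○ ∷ ⊖ ∷ ⊕ ∷ ○ ∷ ○ ∷ ⊕ ∷ [])

-- Multiplying by `a` switches a normalised pattern to agree with the trace. On every edge of K₄ the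
-- four kinds of trace are exactly as numerous as the patterns in the four pools.
deal : ∀ {n} → List Extension → List Extension → List Extension → List Extension →
       Vec (Maybe Sign × Maybe Sign) n → Vec Extension n
-- The edge `uv` is negative, so the sign at `v` is opposite to `a`, as the pool assumes.
deal (x ∷ xs) us vs os ((just a  , just _)  ∷ ts) = Vec.map (Maybe.map (a ·_)) x ∷ deal xs us vs os ts
deal xs (x ∷ us) vs os ((just a  , nothing) ∷ ts) = Vec.map (Maybe.map (a ·_)) x ∷ deal xs us vs os ts
deal xs us (x ∷ vs) os ((nothing , just a)  ∷ ts) = Vec.map (Maybe.map (a ·_)) x ∷ deal xs us vs os ts
deal xs us vs (x ∷ os) ((nothing , nothing) ∷ ts) = x ∷ deal xs us vs os ts
deal xs us vs os       (_ ∷ ts)                   = Vec.replicate _ nothing ∷ deal xs us vs os ts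
deal xs us vs os       []                         = []

-- A copy carries total weight `28 * 85` and each class gives it 14, or 13 if it contains both ends;
-- so `172 * 14 - 28 * 85 = 28` classes contain both. This leaves each vertex `85 - 3 * 28 = 1`
-- class of its own.
traces : Vec (Vec (Maybe Sign) 4) 172
traces =
  Vec.replicate 28 (⊕ ∷ ⊖ ∷ ○ ∷ ○ ∷ []) Vec.++
  Vec.replicate 28 (⊕ ∷ ○ ∷ ⊖ ∷ ○ ∷ []) Vec.++
  Vec.replicate 28 (⊕ ∷ ○ ∷ ○ ∷ ⊖ ∷ []) Vec.++
  Vec.replicate 28 (○ ∷ ⊕ ∷ ⊖ ∷ ○ ∷ []) Vec.++
  Vec.replicate 28 (○ ∷ ⊕ ∷ ○ ∷ ⊖ ∷ []) Vec.++
  Vec.replicate 28 (○ ∷ ○ ∷ ⊕ ∷ ⊖ ∷ []) Vec.++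
  (⊕ ∷ ○ ∷ ○ ∷ ○ ∷ []) ∷
  (○ ∷ ⊕ ∷ ○ ∷ ○ ∷ []) ∷
  (○ ∷ ○ ∷ ⊕ ∷ ○ ∷ []) ∷
  (○ ∷ ○ ∷ ○ ∷ ⊕ ∷ []) ∷ []

copySigns : Fin 6 → Vec Extension 172
copySigns e = deal poolUV poolU poolV pool∅
  (Vec.map (λ t → lookup t (proj₁ (k4edge e)) , lookup t (proj₂ (k4edge e))) traces)

Class : Set
Class = Vec (Maybe Sign) 4 × Vec Extension 6

classes : Vec Class 172
classes = Vec.zip traces (Vec.transpose (Vec.tabulate copySigns))

-- An apex belongs to a class that has at most one vertex in its triangle.
apexSign : List (Maybe Sign) → Maybe Sign
apexSign []             = just pos
apexSign (nothing ∷ ms) = apexSign ms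
apexSign (just a  ∷ ms) = maybe (λ _ → nothing) (just (neg · a)) (foldr _<∣>_ nothing ms)

coreSign : Class → VG₁ → Maybe Sign
coreSign (t , xs) (inj₁ i)              = lookup t i
coreSign (t , xs) (inj₂ (inj₁ (e , l))) = lookup (lookup xs e) l
coreSign (t , xs) (inj₂ (inj₂ _))       = nothing

sign : Class → VG₁ → Maybe Sign
sign c (inj₂ (inj₂ (e , j))) = apexSign (map (coreSign c ∘ emb e) (triangleVertices j))
sign c x                     = coreSign c x

IsSwitching-sign : VecAll.All (IsSwitching ∘ sign) classes
IsSwitching-sign = from-yes (VecAll.all?
  (λ c → All.all? (λ (x , y , s) → compatible? (sign c x) (sign c y) s) edgesG₁) classes)

-- For an apex: four classes miss its triangle and have weight one on its K₄, all others have weight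
-- two, and `2 * 172 - 4 - 3 * 85 = 85`.
∣supports∣≡85 : ∀ v → ∣ supports (Vec.map sign classes) v ∣ ≡ 85
∣supports∣≡85 (inj₁ i) =
  from-yes (Fin.all? λ i → ∣ supports (Vec.map sign classes) (inj₁ i) ∣ ℕ.≟ 85) i
∣supports∣≡85 (inj₂ (inj₁ (e , l))) =
  from-yes (Fin.all? λ e → Fin.all? λ l → ∣ supports (Vec.map sign classes) (inj₂ (inj₁ (e , l))) ∣ ℕ.≟ 85) e l
∣supports∣≡85 (inj₂ (inj₂ (e , j))) =
  from-yes (Fin.all? λ e → Fin.all? λ j → ∣ supports (Vec.map sign classes) (inj₂ (inj₂ (e , j))) ∣ ℕ.≟ 85) e j

colouring : BalancedColoring G₁ 172 85
colouring = switchings⇒colouring (Vec.map sign classes)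
  (λ i → subst IsSwitching (sym (lookup-map i sign classes)) (lookup⁺ IsSwitching-sign i))
  ∣supports∣≡85

theorem3 : (Σ ℕ λ p → Σ ℕ λ q → (1 ≤ q) × (85 * p ≡ 172 * q) × BalancedColoring G₁ p q)
    × ((p q : ℕ) → 1 ≤ q → BalancedColoring G₁ p q → 172 * q ≤ 85 * p)
theorem3 = (172 , 85 , s≤s z≤n , refl , colouring) , λ p q _ → lower-bound p q
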